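{- Given an unweighted directed graph $G$ with $m$ edges that has a directed spanning tree (DST), such a DST can be computed in time $O(m)$ (no root of a DST is given as part of the input).
   Context: Graphs $G=(V,E)$ have vertex set $V=\{1,\dots,n\}$ and $m=|E|$ edges. An out-branching of a directed graph $G$ is an acyclic subgraph $B=(V,E')$ with $E'\subseteq E$ in which each vertex has in-degree at most $1$. A directed spanning tree (DST) is a weakly connected out-branching; it has $n-1$ edges and exactly one vertex of in-degree $0$, its root. The existence of a DST implies $m\ge n-1$. Model: word RAM with word size in $\Omega(\log n)$; the graph is given by (out-)adjacency lists whose lengths can be queried in constant time. -}

module Defs where

open import Data.Bool using (Bool; if_then_else_; _∧_; _∨_; _xor_)
open import Data.Fin using (Fin; toℕ; fromℕ<)
open import Data.List using (List; length; sum; tabulate; head; drop)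
open import Data.List.Membership.Propositional using (_∈_)
open import Data.List.Relation.Unary.Unique.Propositional using (Unique)
open import Data.Maybe using (Maybe; just; nothing; maybe′)
import Data.Maybe as Maybe
open import Data.Nat
  using (ℕ; zero; suc; _+_; _∸_; _*_; _^_; _/_; _%_; _≡ᵇ_; _<ᵇ_; _<?_)
open import Data.Nat.Properties using (m^n≢0)
open import Function using (_∘_; _⇔_)
open import Level using (0ℓ)
open import Relation.Binary using (Rel)
open import Relation.Binary.Construct.Closure.Equivalence using (EqClosure)
open import Relation.Binary.Construct.Closure.Transitive using (TransClosure)
open import Relation.Binary.PropositionalEquality using (_≡_)
open import Relation.Nullary using (¬_; yes; no)

-- A directed graph given by its out-adjacency lists, in an arbitrary order.
-- `unique` makes the edges a set, i.e. there are no parallel edges.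
record Digraph (n : ℕ) : Set where
  field
    out    : Fin n → List (Fin n)
    unique : ∀ v → Unique (out v)

  Edge : Rel (Fin n) 0ℓ
  Edge u v = v ∈ out u

  edgeCount : ℕ
  edgeCount = sum (tabulate (length ∘ out))

-- The relation E′ is the edge set of a subgraph (V , E′).
record IsOutBranching {n} (G : Digraph n) (E′ : Rel (Fin n) 0ℓ) : Set where
  field
    subgraph   : ∀ {u v} → E′ u v → Digraph.Edge G u v
    acyclic    : ∀ v → ¬ TransClosure E′ v v
    inDegree≤1 : ∀ {u u′ v} → E′ u v → E′ u′ v → u ≡ u′

record IsDST {n} (G : Digraph n) (E′ : Rel (Fin n) 0ℓ) : Set where
  field
    isOutBranching  : IsOutBranching G E′
    weaklyConnected : ∀ u v → EqClosure E′ u v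

-- Inside the machine the vertices are named 1, …, n.
name : ∀ {n} → Fin n → ℕ
name v = suc (toℕ v)

vertex? : ∀ n → ℕ → Maybe (Fin n)
vertex? n zero = nothing
vertex? n (suc i) with i <? n
... | yes i<n = just (fromℕ< i<n)
... | no  _   = nothing

nth : ∀ {A : Set} → List A → ℕ → Maybe A
nth xs i = head (drop i xs)

Reg Label : Set
Reg   = ℕ
Label = ℕ

data Op : Set where
  add sub mul div mod and or xor shl shr eq lt : Op

-- The input is read-only: it is accessed only through `order`, `degree` and
-- `neighbour`.
data Instr : Set where
  const     : (r : Reg) (k : ℕ)       → Instr  -- r ← k
  op        : Op → (r s t : Reg)      → Instr  -- r ← s ∙ t
  load      : (r a : Reg)             → Instr  -- r ← mem[a]
  store     : (a s : Reg)             → Instr  -- mem[a] ← s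
  jump      : (ℓ : Label)             → Instr
  jumpZero  : (r : Reg) (ℓ : Label)   → Instr  -- jump to ℓ if r = 0
  order     : (r : Reg)               → Instr  -- r ← number of vertices
  degree    : (r s : Reg)             → Instr  -- r ← length of the list of s
  neighbour : (r s i : Reg)           → Instr  -- r ← entry i (from 0) of the list of s

-- Labels are positions in the program.
Program : Set
Program = List Instr

record State : Set where
  constructor state
  field
    pc   : Label
    regs : Reg → ℕ
    mem  : ℕ → ℕ

open State public

initial : State
initial = state 0 (λ _ → 0) (λ _ → 0)

_[_≔_] : (ℕ → ℕ) → ℕ → ℕ → (ℕ → ℕ)
(f [ x ≔ a ]) y = if y ≡ᵇ x then a else f y

-- The word RAM with w-bit words on input G. Every value is reduced modulo 2 ^ w
-- when written to a register, so registers, memory cells and addresses are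
-- always w-bit words.
module WordRAM (w : ℕ) {n : ℕ} (G : Digraph n) where
  open Digraph G

  wrap : ℕ → ℕ
  wrap x = _%_ x (2 ^ w) {{m^n≢0 2 w}}

  bit : ℕ → Bool
  bit x = x % 2 ≡ᵇ 1

  fromBit : Bool → ℕ
  fromBit b = if b then 1 else 0

  bitwise : (Bool → Bool → Bool) → ℕ → ℕ → ℕ → ℕ
  bitwise f zero    x y = 0
  bitwise f (suc i) x y =
    fromBit (f (bit x) (bit y)) + 2 * bitwise f i (x / 2) (y / 2)

  -- Results are taken modulo 2 ^ w by the caller. Subtraction wraps around, since
  -- x + (2 ^ w - y) ≡ x - y for y < 2 ^ w. Division by zero gives 0.
  ⟦_⟧ : Op → ℕ → ℕ → ℕ
  ⟦ add ⟧ x y       = x + y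
  ⟦ sub ⟧ x y       = x + (2 ^ w ∸ y)
  ⟦ mul ⟧ x y       = x * y
  ⟦ div ⟧ x zero    = 0
  ⟦ div ⟧ x (suc y) = x / suc y
  ⟦ mod ⟧ x zero    = 0
  ⟦ mod ⟧ x (suc y) = x % suc y
  ⟦ and ⟧ x y       = bitwise _∧_ w x y
  ⟦ or  ⟧ x y       = bitwise _∨_ w x y
  ⟦ xor ⟧ x y       = bitwise _xor_ w x y
  ⟦ shl ⟧ x y       = x * 2 ^ y
  ⟦ shr ⟧ x y       = _/_ x (2 ^ y) {{m^n≢0 2 y}}
  ⟦ eq  ⟧ x y       = fromBit (x ≡ᵇ y)
  ⟦ lt  ⟧ x y       = fromBit (x <ᵇ y)

  -- Queries outside the range of the input return 0, which names no vertex.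
  degreeOf : ℕ → ℕ
  degreeOf x = maybe′ (length ∘ out) 0 (vertex? n x)

  neighbourOf : ℕ → ℕ → ℕ
  neighbourOf x i = maybe′ (λ v → maybe′ name 0 (nth (out v) i)) 0 (vertex? n x)

  set : Reg → ℕ → State → State
  set r x σ = state (suc (pc σ)) (regs σ [ r ≔ wrap x ]) (mem σ)

  exec : Instr → State → State
  exec (const r k)       σ = set r k σ
  exec (op o r s t)      σ = set r (⟦ o ⟧ (regs σ s) (regs σ t)) σ
  exec (load r a)        σ = set r (mem σ (regs σ a)) σ
  exec (store a s)       σ =
    state (suc (pc σ)) (regs σ) (mem σ [ regs σ a ≔ regs σ s ])
  exec (jump ℓ)          σ = state ℓ (regs σ) (mem σ)
  exec (jumpZero r ℓ)    σ =
    state (if regs σ r ≡ᵇ 0 then ℓ else suc (pc σ)) (regs σ) (mem σ)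
  exec (order r)         σ = set r n σ
  exec (degree r s)      σ = set r (degreeOf (regs σ s)) σ
  exec (neighbour r s i) σ = set r (neighbourOf (regs σ s) (regs σ i)) σ

  -- The machine halts when pc leaves the program.
  step : Program → State → Maybe State
  step P σ = Maybe.map (λ i → exec i σ) (nth P (pc σ))

  -- P started in σ halts in τ after exactly t instructions.
  data _⊢_⇓[_]_ (P : Program) : State → ℕ → State → Set where
    halted : ∀ {σ} → step P σ ≡ nothing → P ⊢ σ ⇓[ 0 ] σ
    next   : ∀ {σ σ′ τ t} → step P σ ≡ just σ′ →
             P ⊢ σ′ ⇓[ t ] τ → P ⊢ σ ⇓[ suc t ] τ

-- A subgraph of in-degree at most 1 is output as a parent array: cell v of the
-- memory holds the tail of the edge entering v, or 0 if no edge enters v.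
record Represents {n} (M : ℕ → ℕ) (E′ : Rel (Fin n) 0ℓ) : Set where
  field
    edge   : ∀ u v → E′ u v ⇔ M (name v) ≡ name u
    noEdge : ∀ v → (∀ u → ¬ E′ u v) → M (name v) ≡ 0

{-# OPTIONS --safe #-}
-- Search the graph from every vertex that is still unvisited. If some vertex r
-- reaches all others, then after the search that visits r everything is visited, so
-- the latest start vertex reaches r and hence everything. A second search, from that
-- vertex alone, builds the tree as a parent array. Each search pays for its steps from a
-- potential that charges every vertex its out-degree plus one while it is unvisited
-- or on the stack, and n ≤ 1 + m since every vertex but the root has an in-edge.
module Submission where

open import Defs
open import Data.Bool using (true; false; if_then_else_)
open import Data.Empty using (⊥-elim)
open import Data.Fin using (Fin; toℕ; fromℕ<) renaming (zero to fzero; suc to fsuc)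
import Data.Fin as Fin
open import Data.Fin.Properties
  using (injective⇒≤; toℕ-injective; toℕ-fromℕ<; toℕ<n; fromℕ<-toℕ)
open import Data.List using (List; []; _∷_; length; lookup; concat; map; tabulate; head; drop)
open import Data.List.Membership.Propositional using (_∈_)
open import Data.List.Membership.Propositional.Properties using (∈-concat⁺′; ∈-tabulate⁺; ∈-lookup)
open import Data.List.Properties using (length-++; tabulate-cong)
open import Data.List.Relation.Unary.All as All using ()
open import Data.List.Relation.Unary.AllPairs using (_∷_)
open import Data.List.Relation.Unary.Any using (index; here; there)
open import Data.List.Relation.Unary.Any.Properties using (lookup-index)
open import Data.List.Relation.Unary.Unique.Propositional using (Unique)
open import Data.Maybe using (Maybe; just; nothing; maybe′)
import Data.Maybe as Maybe
open import Data.Nat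
  using (ℕ; zero; suc; _+_; _*_; _∸_; _^_; _≤_; _<_; _≡ᵇ_; _<?_; z≤n; s≤s; NonZero; >-nonZero⁻¹; ⌈_/2⌉)
open import Data.Nat.DivMod using (m<n⇒m%n≡m)
open import Data.Nat.Induction using (<-wellFounded)
open import Data.Nat.ListAction using (sum)
open import Data.Nat.Logarithm using (⌈log₂_⌉)
open import Data.Nat.Logarithm.Core using (⌈log2⌉)
open import Data.Nat.Properties
open import Data.Nat.Tactic.RingSolver using (solve-∀)
open import Data.Product using (Σ-syntax; ∃-syntax; _×_; _,_; proj₁; proj₂)
open import Data.Sum using (_⊎_; inj₁; inj₂)
import Data.Sum as Sum
open import Data.Unit using (tt)
open import Function using (_∘_; mk⇔; id)
open import Induction.WellFounded using (Acc; acc)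
open import Level using (0ℓ)
open import Relation.Binary using (Rel)
open import Relation.Binary.Construct.Closure.Equivalence as Eq using (EqClosure)
open import Relation.Binary.Construct.Closure.ReflexiveTransitive as Star using (Star; ε; _◅_; _◅◅_)
open import Relation.Binary.Construct.Closure.Symmetric using (fwd; bwd)
open import Relation.Binary.Construct.Closure.Transitive using (TransClosure; [_]; _∷_)
open import Relation.Binary.PropositionalEquality
open import Relation.Nullary using (¬_; yes; no)

-- Reachability and counting in directed graphs

open import Defs
open import Data.Empty using (⊥-elim)
open import Data.Fin using (Fin; toℕ; fromℕ<) renaming (zero to fzero; suc to fsuc)
open import Data.Fin.Properties using (injective⇒≤; toℕ-injective)
open import Data.List using (List; []; _∷_; length; lookup; concat; tabulate)
open import Data.Nat.ListAction using (sum)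
open import Data.List.Membership.Propositional using (_∈_)
open import Data.List.Membership.Propositional.Properties using (∈-concat⁺′; ∈-tabulate⁺; ∈-lookup)
open import Data.List.Properties using (length-++)
open import Data.List.Relation.Unary.All as All using ()
open import Data.List.Relation.Unary.AllPairs using (_∷_)
open import Data.List.Relation.Unary.Any using (index; here; there)
open import Data.List.Relation.Unary.Any.Properties using (lookup-index)
open import Data.List.Relation.Unary.Unique.Propositional using (Unique)
open import Data.Nat using (ℕ; zero; suc; _+_; _*_; _^_; _≤_; _<_; z≤n; s≤s; NonZero; ⌈_/2⌉)
open import Data.Nat.Logarithm using (⌈log₂_⌉)
open import Data.Nat.Logarithm.Core using (⌈log2⌉)
open import Data.Nat.Properties
open import Data.Nat.Induction using (<-wellFounded)
open import Data.Product using (Σ; Σ-syntax; ∃; ∃-syntax; _×_; _,_; proj₁; proj₂)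
open import Data.Sum using (_⊎_; inj₁; inj₂)
open import Function using (_∘_; _⇔_; mk⇔; id)
open import Induction.WellFounded using (Acc; acc)
open import Level using (0ℓ)
open import Relation.Binary using (Rel)
open import Relation.Binary.Construct.Closure.Equivalence as Eq using (EqClosure)
open import Relation.Binary.Construct.Closure.ReflexiveTransitive as Star using (Star; ε; _◅_; _◅◅_)
open import Relation.Binary.Construct.Closure.Symmetric using (fwd; bwd)
open import Relation.Binary.Construct.Closure.Transitive using (TransClosure; [_]; _∷_; _∷ʳ_)
open import Relation.Binary.PropositionalEquality
open import Relation.Nullary using (¬_)

-- The forest of the first search is not yet the answer: the latest start vertex reaches everything,
-- but vertices found earlier may hang below earlier starts. What the search maintains is that each
-- visited vertex either lies in the tree of the latest start or fails to reach some vertex. A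
-- change of start preserves this, because with an empty stack no edge leaves the visited set, so
-- the new start is out of reach of everything visited so far. Both passes run the same code, and no
-- memory is ever cleared. A base `b` puts the parent cells at `b + 1`, ..., `b + n` and the link
-- cells directly after them. The first pass has `b = n + n`, so the second, with `b = 0`, finds its
-- cells 1, ..., 2n still blank, and its parent cells are those where the output is expected. Since
-- `n` is positive, whether `b` is zero also tells the program which pass it is in. The second pass
-- begins with the counter of start vertices at `n`, so no further start is tried. The largest
-- address is 4n, which determines the word size.

n≤2^⌈log₂n⌉ : ∀ n → n ≤ 2 ^ ⌈log₂ n ⌉
n≤2^⌈log₂n⌉ n = go n (<-wellFounded n)
  where
  m≤2*⌈m/2⌉ : ∀ m → m ≤ 2 * ⌈ m /2⌉
  m≤2*⌈m/2⌉ zero          = z≤n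
  m≤2*⌈m/2⌉ (suc zero)    = s≤s z≤n
  m≤2*⌈m/2⌉ (suc (suc m)) = begin
    2 + m                ≤⟨ +-monoʳ-≤ 2 (m≤2*⌈m/2⌉ m) ⟩
    2 + 2 * ⌈ m /2⌉      ≡⟨ *-suc 2 ⌈ m /2⌉ ⟨
    2 * suc ⌈ m /2⌉      ∎
    where open ≤-Reasoning

  go : ∀ n (a : Acc _<_ n) → n ≤ 2 ^ ⌈log2⌉ n a
  go zero          _        = z≤n
  go (suc zero)    _        = s≤s z≤n
  go (suc (suc n)) (acc rs) =
    ≤-trans (m≤2*⌈m/2⌉ (suc (suc n))) (*-monoʳ-≤ 2 (go (suc ⌈ n /2⌉) _))

lookup-injective : ∀ {A : Set} {xs : List A} → Unique xs →
                   ∀ {i j} → lookup xs i ≡ lookup xs j → i ≡ j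
lookup-injective (x∉xs ∷ _) {fzero}  {fzero}  _  = refl
lookup-injective (x∉xs ∷ _) {fzero}  {fsuc j} e = ⊥-elim (All.lookup x∉xs (∈-lookup j) e)
lookup-injective (x∉xs ∷ _) {fsuc i} {fzero}  e = ⊥-elim (All.lookup x∉xs (∈-lookup i) (sym e))
lookup-injective (_ ∷ xs!)  {fsuc i} {fsuc j} e = cong fsuc (lookup-injective xs! e)

Unique⇒length≤ : ∀ {n} {xs : List (Fin n)} → Unique xs → length xs ≤ n
Unique⇒length≤ xs! = injective⇒≤ (lookup-injective xs!)

covering⇒≤length : ∀ {n} (xs : List (Fin n)) → (∀ v → v ∈ xs) → n ≤ length xs
covering⇒≤length xs v∈xs = injective⇒≤ {f = λ v → index (v∈xs v)} λ {u} {v} e →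
  trans (lookup-index (v∈xs u)) (trans (cong (lookup xs) e) (sym (lookup-index (v∈xs v))))

length-concat-tabulate : ∀ {A : Set} {n} (f : Fin n → List A) →
                         length (concat (tabulate f)) ≡ sum (tabulate (length ∘ f))
length-concat-tabulate {n = zero}  f = refl
length-concat-tabulate {n = suc n} f =
  trans (length-++ (f fzero)) (cong (length (f fzero) +_) (length-concat-tabulate (f ∘ fsuc)))

name-injective : ∀ {n} {u v : Fin n} → name u ≡ name v → u ≡ v
name-injective e = toℕ-injective (suc-injective e)

unsnoc : ∀ {A : Set} {R : Rel A 0ℓ} {u v} → Star R u v → u ≡ v ⊎ (∃[ x ] Star R u x × R x v)
unsnoc ε = inj₁ refl
unsnoc (uRx ◅ x↝v) with unsnoc x↝v
... | inj₁ refl             = inj₂ (_ , ε , uRx)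
... | inj₂ (y , x↝y , yRv) = inj₂ (y , uRx ◅ x↝y , yRv)

unsnoc⁺ : ∀ {A : Set} {R : Rel A 0ℓ} {u v} → TransClosure R u v →
          ∃[ x ] (u ≡ x ⊎ TransClosure R u x) × R x v
unsnoc⁺ [ uRv ] = _ , inj₁ refl , uRv
unsnoc⁺ (uRx ∷ x↝v) with unsnoc⁺ x↝v
... | y , inj₁ refl , yRv = y , inj₂ [ uRx ] , yRv
... | y , inj₂ x↝y , yRv = y , inj₂ (uRx ∷ x↝y) , yRv

module _ {A : Set} {R : Rel A 0ℓ} (inDegree≤1 : ∀ {u u′ v : A} → R u v → R u′ v → u ≡ u′) where

  -- Induction along the undirected path. A backward step `R x u` prolongs the branch from `w` to
  -- `x`. For a forward step `R u x`, a nonempty branch into `x` must end with this very edge, as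
  -- in-degrees are at most 1, and is cut back to `u`; if the branch is empty, `u` takes over as the
  -- ancestor.
  commonAncestor : ∀ {u v} → EqClosure R u v → ∃[ w ] Star R w u × Star R w v
  commonAncestor ε = _ , ε , ε
  commonAncestor (fwd uRx ◅ x~v) with commonAncestor x~v
  ... | w , w↝x , w↝v with unsnoc w↝x
  ...   | inj₁ refl             = _ , ε , uRx ◅ w↝v
  ...   | inj₂ (y , w↝y , yRx) = w , subst (Star R w) (inDegree≤1 yRx uRx) w↝y , w↝v
  commonAncestor (bwd xRu ◅ x~v) with commonAncestor x~v
  ... | w , w↝x , w↝v = w , w↝x ◅◅ (xRu ◅ ε) , w↝v

  -- Finiteness enters here: a root for `k` vertices is merged with one more vertex by
  -- `commonAncestor`, and whatever reaches the old root reaches all that lies below it.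
  commonRoot : (∀ u v → EqClosure R u v) → A → ∀ {k} (f : Fin k → A) →
               ∃[ r ] (∀ i → Star R r (f i))
  commonRoot conn x {zero}  f = x , λ ()
  commonRoot conn x {suc k} f with commonRoot conn x (f ∘ fsuc)
  ... | w , w↝ with commonAncestor (conn w (f fzero))
  ...   | r , r↝w , r↝f0 = r , λ { fzero → r↝f0 ; (fsuc i) → r↝w ◅◅ w↝ i }

  -- The predecessors of a vertex on a cycle lie on it too, back to the root.
  cycle-back : ∀ {u v} → Star R u v → TransClosure R v v → TransClosure R u u
  cycle-back ε v↝v = v↝v
  cycle-back (uRx ◅ x↝v) v↝v with unsnoc⁺ (cycle-back x↝v v↝v)
  ... | y , y≈x , yRx with inDegree≤1 uRx yRx
  cycle-back (uRx ◅ x↝v) v↝v | y , inj₁ refl , yRx | refl = [ uRx ]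
  cycle-back (uRx ◅ x↝v) v↝v | y , inj₂ x↝y , yRx | refl = uRx ∷ x↝y

module _ {n} (G : Digraph n) where
  open Digraph G

  -- The absence of parallel edges bounds the index into an adjacency list by `n`, so it fits into a
  -- word whose size depends on `n` alone.
  degree≤n : ∀ v → length (out v) ≤ n
  degree≤n v = Unique⇒length≤ (unique v)

  -- The given DST enters the proof only through this root, which serves the analysis and is never
  -- known to the machine.
  DST⇒root : .{{_ : NonZero n}} → ∀ {E′} → IsDST G E′ → ∃[ r ] (∀ v → Star Edge r v)
  DST⇒root T = anyVertex n id
    where
    open IsDST T
    open IsOutBranching isOutBranching
    -- The parameter `n` is fixed here, so the case split that yields a vertex is made on a copy `k`
    -- mapped into `Fin n`.
    anyVertex : ∀ k .{{_ : NonZero k}} → (Fin k → Fin n) → ∃[ r ] (∀ v → Star Edge r v)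
    anyVertex (suc k) f with commonRoot inDegree≤1 weaklyConnected (f fzero) id
    ... | r , r↝ = r , λ v → Star.map subgraph (r↝ v)

  n≤1+edgeCount : ∀ {r} → (∀ v → Star Edge r v) → n ≤ suc edgeCount
  n≤1+edgeCount {r} r↝ =
    subst (λ m → n ≤ suc m) (length-concat-tabulate out) (covering⇒≤length (r ∷ concat (tabulate out)) covers)
    where
    covers : ∀ v → v ∈ r ∷ concat (tabulate out)
    covers v with unsnoc (r↝ v)
    ... | inj₁ r≡v            = here (sym r≡v)
    ... | inj₂ (u , _ , v∈u) = there (∈-concat⁺′ v∈u (∈-tabulate⁺ u))

ParentEdge : ∀ {n} → (Fin n → ℕ) → Rel (Fin n) 0ℓ
ParentEdge parent u v = parent v ≡ name u

-- Acyclicity comes from reachability: by `cycle-back` any cycle would spread up to `r`, whose cell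
-- is 0 and hence admits no entering edge.
parents⇒DST : ∀ {n} (G : Digraph n) (M : ℕ → ℕ) {r} → M (name r) ≡ 0 →
              (∀ v → M (name v) ≡ 0 ⊎ (∃[ u ] M (name v) ≡ name u × Digraph.Edge G u v)) →
              (∀ v → Star (ParentEdge (M ∘ name)) r v) →
              Σ[ E′ ∈ Rel (Fin n) 0ℓ ] (IsDST G E′ × Represents M E′)
parents⇒DST G M {r} r-root parent r↝ = E′ , dst , rep
  where
  E′ = ParentEdge (M ∘ name)
  in≤1 : ∀ {u u′ v} → E′ u v → E′ u′ v → u ≡ u′
  in≤1 e e′ = name-injective (trans (sym e) e′)

  edge-of : ∀ {u v} → E′ u v → Digraph.Edge G u v
  edge-of {u} {v} e with parent v
  ... | inj₁ e′ = ⊥-elim (1+n≢0 (trans (sym e) e′))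
  ... | inj₂ (x , e′ , x→v) = subst (λ y → Digraph.Edge G y v) (in≤1 {v = v} e′ e) x→v

  root-acyclic : ¬ TransClosure E′ r r
  root-acyclic r↝r with unsnoc⁺ r↝r
  ... | _ , _ , e = 1+n≢0 (trans (sym e) r-root)

  dst : IsDST G E′
  dst = record
    { isOutBranching = record
      { subgraph   = edge-of
      ; acyclic    = λ v v↝v → root-acyclic (cycle-back (λ {u} {u′} {v} → in≤1 {u} {u′} {v}) (r↝ v) v↝v)
      ; inDegree≤1 = λ {u} {u′} {v} → in≤1 {u} {u′} {v}
      }
    ; weaklyConnected = λ u v → Eq.symmetric E′ (Star.map fwd (r↝ u)) ◅◅ Star.map fwd (r↝ v)
    }

  rep : Represents M E′
  rep = record
    { edge   = λ u v → mk⇔ id id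
    ; noEdge = noEdge′
    }
    where
    noEdge′ : ∀ v → (∀ u → ¬ E′ u v) → M (name v) ≡ 0
    noEdge′ v none with parent v
    ... | inj₁ e           = e
    ... | inj₂ (u , e , _) = ⊥-elim (none u e)

-- One pass of the search

-- The exchanged terms at `u` are added on opposite sides to avoid truncated subtraction.
sum-tabulate-update : ∀ {n} (f g : Fin n → ℕ) (u : Fin n) → (∀ v → v ≢ u → g v ≡ f v) →
                      sum (tabulate g) + f u ≡ sum (tabulate f) + g u
sum-tabulate-update f g fzero g≗f = begin
  g fzero + sum (tabulate (g ∘ fsuc)) + f fzero
    ≡⟨ cong (λ z → g fzero + sum z + f fzero) (tabulate-cong (λ v → g≗f (fsuc v) λ ())) ⟩
  g fzero + sum (tabulate (f ∘ fsuc)) + f fzero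
    ≡⟨ +-comm _ (f fzero) ⟩
  f fzero + (g fzero + sum (tabulate (f ∘ fsuc)))
    ≡⟨ cong (f fzero +_) (+-comm (g fzero) _) ⟩
  f fzero + (sum (tabulate (f ∘ fsuc)) + g fzero)
    ≡⟨ +-assoc (f fzero) _ _ ⟨
  f fzero + sum (tabulate (f ∘ fsuc)) + g fzero ∎
  where
  open ≡-Reasoning
sum-tabulate-update f g (fsuc u) g≗f = begin
  g fzero + sum (tabulate (g ∘ fsuc)) + f (fsuc u)
    ≡⟨ +-assoc (g fzero) _ _ ⟩
  g fzero + (sum (tabulate (g ∘ fsuc)) + f (fsuc u))
    ≡⟨ cong₂ _+_ (g≗f fzero λ ())
         (sum-tabulate-update (f ∘ fsuc) (g ∘ fsuc) u λ v v≢u → g≗f (fsuc v) λ { refl → v≢u refl }) ⟩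
  f fzero + (sum (tabulate (f ∘ fsuc)) + g (fsuc u))
    ≡⟨ +-assoc (f fzero) _ _ ⟨
  f fzero + sum (tabulate (f ∘ fsuc)) + g (fsuc u) ∎
  where open ≡-Reasoning

sum-tabulate-suc : ∀ {n} (f : Fin n → ℕ) → sum (tabulate (suc ∘ f)) ≡ n + sum (tabulate f)
sum-tabulate-suc {zero}  f = refl
sum-tabulate-suc {suc n} f = cong suc (begin
  f fzero + sum (tabulate (suc ∘ f ∘ fsuc))     ≡⟨ cong (f fzero +_) (sum-tabulate-suc (f ∘ fsuc)) ⟩
  f fzero + (n + sum (tabulate (f ∘ fsuc)))     ≡⟨ +-assoc (f fzero) n _ ⟨
  f fzero + n + sum (tabulate (f ∘ fsuc))       ≡⟨ cong (_+ sum (tabulate (f ∘ fsuc))) (+-comm (f fzero) n) ⟩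
  n + f fzero + sum (tabulate (f ∘ fsuc))       ≡⟨ +-assoc n (f fzero) _ ⟩
  n + (f fzero + sum (tabulate (f ∘ fsuc)))     ∎)
  where open ≡-Reasoning

Visited : ∀ {n} → (Fin n → ℕ) → Fin n → Set
Visited link v = link v ≢ 0

-- A stack threaded through the link cells; suc n names no vertex and marks the
-- bottom, so the link of a vertex that was ever pushed is never 0.
data Stack {n} (link : Fin n → ℕ) : ℕ → List (Fin n) → Set where
  []   : Stack link (suc n) []
  push : ∀ {v xs} → Stack link (link v) xs → Stack link (name v) (v ∷ xs)

top≢0 : ∀ {n} {link : Fin n → ℕ} {top xs} → Stack link top xs → top ≢ 0
top≢0 []       ()
top≢0 (push _) ()

top≤ : ∀ {n} {link : Fin n → ℕ} {top xs} → Stack link top xs → top ≤ suc n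
top≤ []           = ≤-refl
top≤ (push {v} _) = s≤s (<⇒≤ (toℕ<n v))

Stack-cong : ∀ {n} {link link′ : Fin n → ℕ} {top xs} →
             (∀ v → Visited link v → link′ v ≡ link v) → Stack link top xs → Stack link′ top xs
Stack-cong same []       = []
Stack-cong {link′ = link′} same (push {v} st) =
  push (subst (λ t → Stack link′ t _) (sym (same v (top≢0 st))) (Stack-cong same st))

-- The effect of a discovery on the two arrays, free of addresses, so that the invariant can be
-- treated independently of the memory layout.
record Discovers {n} (link parent link′ parent′ : Fin n → ℕ) (u : Fin n) (top p : ℕ) : Set where
  field
    link-u   : link′ u ≡ top
    parent-u : parent′ u ≡ p
    link-≢   : ∀ v → v ≢ u → link′ v ≡ link v
    parent-≢ : ∀ v → v ≢ u → parent′ v ≡ parent v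

module Search {n} (G : Digraph n) where
  open Digraph G

  outs : Maybe (Fin n) → List (Fin n)
  outs = maybe′ out []

  -- The code 0 of `nothing` serves twice: a neighbour query on it returns 0, as at the end of a
  -- list, and stored as a parent it marks a root.
  nameOf : Maybe (Fin n) → ℕ
  nameOf = maybe′ name 0

  Reached : (parent : Fin n → ℕ) (last : ℕ) → Fin n → Set
  Reached parent last v = ∃[ ℓ ] last ≡ name ℓ × Star (ParentEdge parent) ℓ v

  -- A vertex that was left behind by an earlier search. In the second pass
  -- s₀ = n, so no vertex is lost there.
  Lost : ℕ → Fin n → Set
  Lost s₀ v = s₀ < n × (∃[ x ] ¬ Star Edge v x)

  -- The state in front of the next edge of cur: rest are the heads of the edges of
  -- cur still to be examined, xs is the stack, last is the latest start vertex,
  -- and the vertices from s₀ up to s have been tried as start vertices.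
  record Inv (s₀ s last top : ℕ) (link parent : Fin n → ℕ)
             (cur : Maybe (Fin n)) (rest xs : List (Fin n)) : Set where
    field
      s₀≤s    : s₀ ≤ s
      s≤n     : s ≤ n
      scanned : ∀ v → s₀ ≤ toℕ v → toℕ v < s → Visited link v
      stack   : Stack link top xs
      bounded : ∀ v → link v ≤ suc n
      edges   : ∀ v {x} → cur ≡ just v → x ∈ rest → Edge v x
      closed  : ∀ v → Visited link v → v ∈ xs ⊎
                (∀ {x} → Edge v x → Visited link x ⊎ (cur ≡ just v × x ∈ rest))
      tree    : ∀ v → parent v ≡ 0 ⊎ (∃[ u ] parent v ≡ name u × Edge u v)
      fresh   : ∀ v → link v ≡ 0 → parent v ≡ 0
      reached : ∀ v → Visited link v → Reached parent last v ⊎ Lost s₀ v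
      pending : ∀ v → v ∈ xs ⊎ cur ≡ just v → Reached parent last v
      start   : ∀ ℓ → last ≡ name ℓ → Visited link ℓ × parent ℓ ≡ 0

  -- The potential

  weight : Fin n → ℕ
  weight v = suc (length (out v))

  unseen : ℕ → ℕ → ℕ
  unseen zero    w = w
  unseen (suc _) w = 0

  unseenWeight : (Fin n → ℕ) → ℕ
  unseenWeight link = sum (tabulate λ v → unseen (link v) (weight v))

  -- Every round that does not end the pass lowers this by exactly one: an examined edge leaves
  -- `rest`, a popped vertex trades its weight for its out-degree in `rest`, and a tried start
  -- vertex lowers `n ∸ s`. Discovery is free, since it only moves a weight from the unseen vertices
  -- to the stack.
  Φ : ℕ → (Fin n → ℕ) → (rest xs : List (Fin n)) → ℕ
  Φ s link rest xs = unseenWeight link + sum (map weight xs) + length rest + (n ∸ s)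

  unseenWeight-fresh : ∀ {link} → (∀ v → link v ≡ 0) → unseenWeight link ≡ n + edgeCount
  unseenWeight-fresh {link} zeros = trans (cong sum (tabulate-cong λ v → cong (λ l → unseen l (weight v)) (zeros v)))
    (sum-tabulate-suc (length ∘ out))

  Φ-rest : ∀ s link u us xs → Φ s link (u ∷ us) xs ≡ suc (Φ s link us xs)
  Φ-rest s link u us xs = cong (_+ (n ∸ s)) (+-suc (unseenWeight link + sum (map weight xs)) (length us))

  Φ-pop : ∀ s link v xs → Φ s link [] (v ∷ xs) ≡ suc (Φ s link (out v) xs)
  Φ-pop s link v xs = cong (_+ (n ∸ s)) (begin
    a + (suc d + b) + 0 ≡⟨ +-identityʳ _ ⟩
    a + suc (d + b)     ≡⟨ +-suc a (d + b) ⟩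
    suc (a + (d + b))   ≡⟨ cong (λ z → suc (a + z)) (+-comm d b) ⟩
    suc (a + (b + d))   ≡⟨ cong suc (+-assoc a b d) ⟨
    suc (a + b + d)     ∎)
    where
    open ≡-Reasoning
    a = unseenWeight link
    b = sum (map weight xs)
    d = length (out v)

  Φ-scan : ∀ {s} link rest xs → s < n → Φ s link rest xs ≡ suc (Φ (suc s) link rest xs)
  Φ-scan {s} link rest xs s<n = begin
    a + (n ∸ s)           ≡⟨ cong (a +_) (+-∸-assoc 1 s<n) ⟩
    a + suc (n ∸ suc s)   ≡⟨ +-suc a (n ∸ suc s) ⟩
    suc (a + (n ∸ suc s)) ∎
    where
    open ≡-Reasoning
    a = unseenWeight link + sum (map weight xs) + length rest

  -- Discoveries preserve the invariant

  module _ {link parent link′ parent′ : Fin n → ℕ} {u : Fin n} {top p : ℕ}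
           (disc : Discovers {n} link parent link′ parent′ u top p)
           (unseen-u : link u ≡ 0) (top≢0 : top ≢ 0) where
    open Discovers disc

    unseenWeight-discovers : unseenWeight link′ + weight u ≡ unseenWeight link
    unseenWeight-discovers = begin
      unseenWeight link′ + weight u
        ≡⟨ cong (λ l → unseenWeight link′ + unseen l (weight u)) unseen-u ⟨
      unseenWeight link′ + unseen (link u) (weight u)
        ≡⟨ sum-tabulate-update _ _ u (λ v v≢u → cong (λ l → unseen l (weight v)) (link-≢ v v≢u)) ⟩
      unseenWeight link + unseen (link′ u) (weight u)
        ≡⟨ cong (unseenWeight link +_) (seen (subst (_≢ 0) (sym link-u) top≢0)) ⟩
      unseenWeight link + 0 ≡⟨ +-identityʳ _ ⟩
      unseenWeight link     ∎
      where
      open ≡-Reasoning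
      seen : ∀ {l w} → l ≢ 0 → unseen l w ≡ 0
      seen {zero}  l≢0 = ⊥-elim (l≢0 refl)
      seen {suc l} l≢0 = refl

    Φ-discovers : ∀ s rest xs → Φ s link′ rest (u ∷ xs) ≡ Φ s link rest xs
    Φ-discovers s rest xs = cong (λ z → z + length rest + (n ∸ s)) (begin
      unseenWeight link′ + (weight u + sum (map weight xs)) ≡⟨ +-assoc (unseenWeight link′) _ _ ⟨
      unseenWeight link′ + weight u + sum (map weight xs)   ≡⟨ cong (_+ sum (map weight xs)) unseenWeight-discovers ⟩
      unseenWeight link + sum (map weight xs)               ∎)
      where open ≡-Reasoning

    visited-u : Visited link′ u
    visited-u = subst (_≢ 0) (sym link-u) top≢0

    visited⇒≢ : ∀ {v} → Visited link v → v ≢ u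
    visited⇒≢ vis refl = vis unseen-u

    visited-mono : ∀ {v} → Visited link v → Visited link′ v
    visited-mono vis = subst (_≢ 0) (sym (link-≢ _ (visited⇒≢ vis))) vis

    visited-≢ : ∀ {v} → v ≢ u → Visited link′ v → Visited link v
    visited-≢ v≢u = subst (_≢ 0) (link-≢ _ v≢u)

    module _ {s₀ s last : ℕ} {cur : Maybe (Fin n)} {rest rest′ xs : List (Fin n)}
             (inv : Inv s₀ s last top link parent cur rest xs)
             (rest⊆ : ∀ {x : Fin n} → x ∈ rest → x ≡ u ⊎ x ∈ rest′)
             (rest′⊆ : ∀ {x : Fin n} → x ∈ rest′ → x ∈ rest) where
      open Inv inv

      ParentEdge-mono : ∀ {x y} → ParentEdge parent x y → ParentEdge parent′ x y
      ParentEdge-mono {x} {y} e = trans (parent-≢ y y≢u) e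
        where
        y≢u : y ≢ u
        -- Only the parent of `u` is overwritten, and by `fresh` it was 0, so no tree edge is
        -- destroyed.
        y≢u refl = 1+n≢0 (trans (sym e) (fresh u unseen-u))

      Reached-mono : ∀ {v} → Reached parent last v → Reached parent′ last v
      Reached-mono (ℓ , last≡ , ℓ↝v) = ℓ , last≡ , Star.map (λ {x} {y} → ParentEdge-mono {x} {y}) ℓ↝v

      -- Common to children and start vertices; the arguments are the parts that depend on the
      -- parent of `u` and on whether the tree is continued or begun anew.
      discover : ∀ {last′} →
                 (p ≡ 0 ⊎ (∃[ v ] p ≡ name v × Edge v u)) →
                 (∀ v → Visited link v → Reached parent′ last′ v ⊎ Lost s₀ v) →
                 (∀ v → v ∈ u ∷ xs ⊎ cur ≡ just v → Reached parent′ last′ v) →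
                 (∀ ℓ → last′ ≡ name ℓ → Visited link′ ℓ × parent′ ℓ ≡ 0) →
                 Inv s₀ s last′ (name u) link′ parent′ cur rest′ (u ∷ xs)
      discover p-ok reached′ pending′ start′ = record
        { s₀≤s    = s₀≤s
        ; s≤n     = s≤n
        ; scanned = λ v s₀≤v v<s → visited-mono (scanned v s₀≤v v<s)
        ; stack   = push (subst (λ t → Stack link′ t xs) (sym link-u)
                            (Stack-cong (λ v vis → link-≢ v (visited⇒≢ vis)) stack))
        ; bounded = λ v → case-u v
            (λ { refl → subst (_≤ suc n) (sym link-u) (top≤ stack) })
            (λ v≢u → subst (_≤ suc n) (sym (link-≢ v v≢u)) (bounded v))
        ; edges   = λ v cur≡ x∈ → edges v cur≡ (rest′⊆ x∈)
        ; closed  = closed′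
        ; tree    = tree′
        ; fresh   = fresh′
        ; reached = λ v vis → case-u v
            (λ v≡u → inj₁ (pending′ v (inj₁ (here v≡u))))
            (λ v≢u → reached′ v (visited-≢ v≢u vis))
        ; pending = pending′
        ; start   = start′
        }
        where
        case-u : ∀ {C : Set} v → (v ≡ u → C) → (v ≢ u → C) → C
        case-u v f g with v Fin.≟ u
        ... | yes v≡u = f v≡u
        ... | no  v≢u = g v≢u

        closed′ : ∀ v → Visited link′ v → v ∈ u ∷ xs ⊎
                  (∀ {x} → Edge v x → Visited link′ x ⊎ (cur ≡ just v × x ∈ rest′))
        closed′ v vis = case-u v (inj₁ ∘ here) λ v≢u → Sum.map there step (closed v (visited-≢ v≢u vis))
          where
          step : (∀ {x} → Edge v x → Visited link x ⊎ (cur ≡ just v × x ∈ rest)) →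
                 ∀ {x} → Edge v x → Visited link′ x ⊎ (cur ≡ just v × x ∈ rest′)
          step old v→x with old v→x
          ... | inj₁ vis-x = inj₁ (visited-mono vis-x)
          ... | inj₂ (cur≡ , x∈) with rest⊆ x∈
          ...   | inj₁ refl = inj₁ visited-u
          ...   | inj₂ x∈′ = inj₂ (cur≡ , x∈′)

        tree′ : ∀ v → parent′ v ≡ 0 ⊎ (∃[ x ] parent′ v ≡ name x × Edge x v)
        tree′ v = case-u v
          (λ { refl → Sum.map (trans parent-u) (λ { (x , p≡ , x→u) → x , trans parent-u p≡ , x→u }) p-ok })
          (λ v≢u → Sum.map (trans (parent-≢ v v≢u))
                     (λ { (x , p≡ , x→v) → x , trans (parent-≢ v v≢u) p≡ , x→v }) (tree v))

        fresh′ : ∀ v → link′ v ≡ 0 → parent′ v ≡ 0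
        fresh′ v l≡0 = case-u v
          (λ { refl → ⊥-elim (visited-u l≡0) })
          (λ v≢u → trans (parent-≢ v v≢u) (fresh v (trans (sym (link-≢ v v≢u)) l≡0)))

  module _ {link parent link′ parent′ : Fin n → ℕ} {s₀ s last top : ℕ} {u : Fin n} where

    discoverChild : ∀ {v us xs} → Discovers link parent link′ parent′ u top (name v) → link u ≡ 0 →
                    Inv s₀ s last top link parent (just v) (u ∷ us) xs →
                    Inv s₀ s last (name u) link′ parent′ (just v) us (u ∷ xs)
    discoverChild {v} {us} {xs} disc unseen-u inv =
      discover disc unseen-u t≢0 inv split there
        (inj₂ (v , refl , edges v refl (here refl)))
        (λ x vis → Sum.map mono id (reached x vis))
        pending′
        (λ ℓ last≡ → let vis , root = start ℓ last≡ in
           visited-mono disc unseen-u t≢0 vis , trans (parent-≢ ℓ (visited⇒≢ disc unseen-u t≢0 vis)) root)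
      where
      open Inv inv
      open Discovers disc
      t≢0 = top≢0 stack
      split : ∀ {x} → x ∈ u ∷ us → x ≡ u ⊎ x ∈ us
      split (here e)  = inj₁ e
      split (there i) = inj₂ i
      mono : ∀ {x} → Reached parent last x → Reached parent′ last x
      mono = Reached-mono disc unseen-u t≢0 inv split there
      pending′ : ∀ x → x ∈ u ∷ xs ⊎ just v ≡ just x → Reached parent′ last x
      pending′ x (inj₁ (there x∈xs)) = mono (pending x (inj₁ x∈xs))
      pending′ x (inj₂ e)            = mono (pending x (inj₂ e))
      -- The weaker `reached` would allow `v` to be `Lost`; `pending` gives a tree path to `v`,
      -- which the new edge extends to `u`.
      pending′ x (inj₁ (here refl)) with mono (pending v (inj₂ refl))
      ... | ℓ , last≡ , ℓ↝v = ℓ , last≡ , ℓ↝v ◅◅ (parent-u ◅ ε)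

    -- The tree of the old start is abandoned, so everything visited before must be `Lost`. In the
    -- first pass `unvisited⇒lost` supplies this; in the second nothing has been visited yet.
    discoverStart : Discovers link parent link′ parent′ u top 0 → link u ≡ 0 →
                    (∀ v → Visited link v → Lost s₀ v) →
                    Inv s₀ s last top link parent nothing [] [] →
                    Inv s₀ s (name u) (name u) link′ parent′ nothing [] (u ∷ [])
    discoverStart disc unseen-u lost inv =
      discover disc unseen-u t≢0 inv (λ ()) (λ ())
        (inj₁ refl) (λ x vis → inj₂ (lost x vis))
        (λ { x (inj₁ (here refl)) → u , refl , ε })
        (λ ℓ e → subst (λ ℓ → Visited link′ ℓ × parent′ ℓ ≡ 0) (name-injective e)
                   (visited-u disc unseen-u t≢0 , parent-u))
      where
      open Inv inv
      open Discovers disc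
      t≢0 = top≢0 stack

  -- The remaining moves, and consequences of an empty stack

  module _ {s₀ s last top : ℕ} {link parent : Fin n → ℕ} where

    skip : ∀ {cur u us xs} → Visited link u →
           Inv s₀ s last top link parent cur (u ∷ us) xs → Inv s₀ s last top link parent cur us xs
    skip {cur} {u} {us} {xs} vis-u inv = record
      { Inv inv hiding (edges; closed)
      ; edges  = λ v cur≡ x∈ → edges v cur≡ (there x∈)
      ; closed = λ v vis → Sum.map id (λ old v→x → drop-u (old v→x)) (closed v vis)
      }
      where
      open Inv inv
      drop-u : ∀ {v x} → Visited link x ⊎ (cur ≡ just v × x ∈ u ∷ us) →
               Visited link x ⊎ (cur ≡ just v × x ∈ us)
      drop-u (inj₁ vis)               = inj₁ vis
      drop-u (inj₂ (_ , here refl))   = inj₁ vis-u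
      drop-u (inj₂ (cur≡ , there x∈)) = inj₂ (cur≡ , x∈)

    finish : ∀ {cur xs} → Inv s₀ s last top link parent cur [] xs →
             Inv s₀ s last top link parent nothing [] xs
    finish inv = record
      { Inv inv hiding (edges; closed; pending)
      ; edges   = λ v ()
      ; closed  = λ v vis → Sum.map id (λ old v→x → Sum.map id (λ ()) (old v→x)) (closed v vis)
      ; pending = λ { v (inj₁ v∈xs) → pending v (inj₁ v∈xs) }
      }
      where open Inv inv

    pop : ∀ {v xs} → Inv s₀ s last top link parent nothing [] (v ∷ xs) →
          Inv s₀ s last (link v) link parent (just v) (out v) xs
    pop {v} {xs} inv = record
      { Inv inv hiding (stack; edges; closed; pending)
      ; stack   = tail stack
      ; edges   = λ { x refl x∈ → x∈ }
      ; closed  = λ x vis → closed′ x (closed x vis)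
      ; pending = λ { x (inj₁ x∈xs) → pending x (inj₁ (there x∈xs))
                    ; x (inj₂ refl) → pending v (inj₁ (here refl)) }
      }
      where
      open Inv inv
      tail : Stack link top (v ∷ xs) → Stack link (link v) xs
      tail (push st) = st
      closed′ : ∀ x → x ∈ v ∷ xs ⊎ (∀ {y} → Edge x y → Visited link y ⊎ (nothing ≡ just x × y ∈ [])) →
                x ∈ xs ⊎ (∀ {y} → Edge x y → Visited link y ⊎ (just v ≡ just x × y ∈ out v))
      -- The popped vertex loses its exemption as a stack member, but all its edges are now still to
      -- be examined.
      closed′ x (inj₁ (here refl)) = inj₂ λ v→y → inj₂ (refl , v→y)
      closed′ x (inj₁ (there x∈))  = inj₁ x∈
      closed′ x (inj₂ old)         = inj₂ λ x→y → Sum.map id (λ ()) (old x→y)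

    advance : ∀ {cur rest xs} (s<n : s < n) → Visited link (fromℕ< s<n) →
              Inv s₀ s last top link parent cur rest xs → Inv s₀ (suc s) last top link parent cur rest xs
    advance s<n vis inv = record
      { Inv inv hiding (s₀≤s; s≤n; scanned)
      ; s₀≤s    = m≤n⇒m≤1+n s₀≤s
      ; s≤n     = s<n
      ; scanned = λ v s₀≤v v<1+s → Sum.[ scanned v s₀≤v
          , (λ v≡s → subst (Visited link) (toℕ-injective (trans (toℕ-fromℕ< s<n) (sym v≡s))) vis) ]
          (m≤n⇒m<n∨m≡n (≤-pred v<1+s))
      }
      where open Inv inv

    module _ (inv : Inv s₀ s last top link parent nothing [] []) where
      open Inv inv

      visited-closed : ∀ {v x} → Visited link v → Star Edge v x → Visited link x
      visited-closed vis ε = vis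
      visited-closed {v} vis (v→y ◅ y↝x) with closed v vis
      ... | inj₂ old with old v→y
      ...   | inj₁ vis-y = visited-closed vis-y y↝x

      unvisited⇒lost : ∀ {u} → s < n → link u ≡ 0 → ∀ v → Visited link v → Lost s₀ v
      unvisited⇒lost {u} s<n unseen-u v vis =
        ≤-<-trans s₀≤s s<n , u , λ v↝u → visited-closed vis v↝u unseen-u

      ParentEdge⇒Edge : ∀ {u v} → ParentEdge parent u v → Edge u v
      ParentEdge⇒Edge {u} {v} e with tree v
      ... | inj₁ e′ = ⊥-elim (1+n≢0 (trans (sym e) e′))
      ... | inj₂ (x , e′ , x→v) = subst (λ y → Edge y v) (name-injective (trans (sym e′) e)) x→v

      -- A vertex that reaches everything cannot be `Lost`, so `r` lies in the tree of the latest
      -- start vertex.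
      last-reaches-all : ∀ {r} → (∀ v → Star Edge r v) → Visited link r →
                         ∃[ ℓ ] last ≡ name ℓ × (∀ v → Star Edge ℓ v)
      last-reaches-all {r} r↝ vis with reached r vis
      ... | inj₁ (ℓ , last≡ , ℓ↝r) =
        ℓ , last≡ , λ v → Star.map (λ {x} {y} → ParentEdge⇒Edge {x} {y}) ℓ↝r ◅◅ r↝ v
      ... | inj₂ (_ , x , r↛x) = ⊥-elim (r↛x (r↝ x))

      -- The visited set is closed under edges and contains `ℓ`, so it is everything; with `n ≤ s₀`
      -- no vertex is `Lost`, so each has a tree path.
      tree-spans : ∀ {ℓ} → n ≤ s₀ → last ≡ name ℓ → (∀ v → Star Edge ℓ v) →
                   ∀ v → Star (ParentEdge parent) ℓ v
      tree-spans {ℓ} n≤s₀ last≡ ℓ↝ v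
        with reached v (visited-closed (proj₁ (start ℓ last≡)) (ℓ↝ v))
      ... | inj₁ (ℓ′ , last≡′ , ℓ′↝v) =
        subst (λ ℓ → Star (ParentEdge parent) ℓ v) (name-injective (trans (sym last≡′) last≡)) ℓ′↝v
      ... | inj₂ (s₀<n , _) = ⊥-elim (<⇒≱ s₀<n n≤s₀)

  Inv-initial : ∀ {s₀ s link parent} → s₀ ≡ s → s ≤ n → (∀ v → link v ≡ 0) → (∀ v → parent v ≡ 0) →
                Inv s₀ s 0 (suc n) link parent nothing [] []
  Inv-initial refl s≤n link≡0 parent≡0 = record
    { s₀≤s    = ≤-refl
    ; s≤n     = s≤n
    ; scanned = λ v s≤v v<s → ⊥-elim (<⇒≱ v<s s≤v)
    ; stack   = []
    ; bounded = λ v → subst (_≤ suc n) (sym (link≡0 v)) z≤n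
    ; edges   = λ v ()
    ; closed  = λ v vis → ⊥-elim (vis (link≡0 v))
    ; tree    = λ v → inj₁ (parent≡0 v)
    ; fresh   = λ v _ → parent≡0 v
    ; reached = λ v vis → ⊥-elim (vis (link≡0 v))
    ; pending = λ { v (inj₁ ()) ; v (inj₂ ()) }
    ; start   = λ ℓ ()
    }

-- The machine program

-- Registers: 0 zero, 1 n, 2 one, 3 the stack bottom n + 1, 4 the base b of the
-- parent cells, 5 the base b + n of the link cells, 6 the top of the stack, 7 the
-- number of start vertices tried, 8 the latest start vertex, 9 the current vertex (0
-- when a start vertex is being tried), 10 the index of its next edge, 11 the head of
-- that edge, 12 and 13 scratch. The numbers below are labels.
searchProgram : Program
searchProgram =
    order 1
  ∷ const 2 1
  ∷ op add 3 1 2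
  ∷ op add 4 1 1
  ∷ op add 5 4 1
  ∷ op add 6 3 0
  -- 6: next edge of the current vertex
  ∷ neighbour 11 9 10
  ∷ jumpZero 11 21
  -- 8: examine vertex r11
  ∷ op add 13 5 11
  ∷ load 12 13
  ∷ jumpZero 12 12
  ∷ jump 19
  -- 12: discover vertex r11
  ∷ store 13 6
  ∷ op add 6 11 0
  ∷ op add 13 4 11
  ∷ store 13 9
  ∷ jumpZero 9 18
  ∷ jump 19
  ∷ op add 8 11 0
  -- 19
  ∷ op add 10 10 2
  ∷ jump 6
  -- 21: no edge left
  ∷ op eq 12 6 3
  ∷ jumpZero 12 35
  ∷ op eq 12 7 1
  ∷ jumpZero 12 30
  -- 25: end of a pass
  ∷ jumpZero 4 40
  ∷ const 4 0
  ∷ op add 5 1 0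
  ∷ op add 11 8 0
  ∷ jump 32
  -- 30: next start vertex
  ∷ op add 7 7 2
  ∷ op add 11 7 0
  -- 32: start from vertex r11
  ∷ const 9 0
  ∷ const 10 0
  ∷ jump 8
  -- 35: pop the current vertex
  ∷ op add 9 6 0
  ∷ op add 13 5 6
  ∷ load 6 13
  ∷ const 10 0
  ∷ jump 6
  ∷ []

≡ᵇ-refl : ∀ x → (x ≡ᵇ x) ≡ true
≡ᵇ-refl zero    = refl
≡ᵇ-refl (suc x) = ≡ᵇ-refl x

≢⇒≡ᵇ-false : ∀ x y → x ≢ y → (x ≡ᵇ y) ≡ false
≢⇒≡ᵇ-false zero    zero    x≢y = ⊥-elim (x≢y refl)
≢⇒≡ᵇ-false zero    (suc y) _   = refl
≢⇒≡ᵇ-false (suc x) zero    _   = refl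
≢⇒≡ᵇ-false (suc x) (suc y) x≢y = ≢⇒≡ᵇ-false x y (x≢y ∘ cong suc)

update-same : ∀ (f : ℕ → ℕ) x a → (f [ x ≔ a ]) x ≡ a
update-same f x a rewrite ≡ᵇ-refl x = refl

update-other : ∀ (f : ℕ → ℕ) x a y → y ≢ x → (f [ x ≔ a ]) y ≡ f y
update-other f x a y y≢x rewrite ≢⇒≡ᵇ-false y x y≢x = refl

vertex?-name : ∀ {n} (v : Fin n) → vertex? n (name v) ≡ just v
vertex?-name {n} v with toℕ v <? n
... | yes v<n = cong just (fromℕ<-toℕ v v<n)
... | no  v≮n = ⊥-elim (v≮n (toℕ<n v))

drop-∷ : ∀ {A : Set} i (xs : List A) {y ys} → drop i xs ≡ y ∷ ys → i < length xs × drop (suc i) xs ≡ ys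
drop-∷ zero    (x ∷ xs) refl = s≤s z≤n , refl
drop-∷ (suc i) (x ∷ xs) e    = let i< , e′ = drop-∷ i xs e in s≤s i< , e′

drop-[] : ∀ {A : Set} i → drop i ([] {A = A}) ≡ []
drop-[] zero    = refl
drop-[] (suc i) = refl

-- Executing the program symbolically

module Machine (w n : ℕ) (G : Digraph n) (4n<2^w : 4 * n < 2 ^ w) (1≤n : 1 ≤ n) (Post : State → Set₁) where
  open Digraph G
  open WordRAM w G
  open Search G

  -- Runs are composed backwards from the halting state: each `run-` lemma for an instruction
  -- prepends it to a bounded run. An upper bound lets branches of different length share one
  -- budget.
  HaltsWithin : ℕ → State → Set₁
  HaltsWithin p σ = ∃[ t ] ∃[ τ ] (searchProgram ⊢ σ ⇓[ t ] τ) × t ≤ p × Post τ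

  weaken : ∀ {p q σ} → p ≤ q → HaltsWithin p σ → HaltsWithin q σ
  weaken p≤q (t , τ , run , t≤p , post) = t , τ , run , ≤-trans t≤p p≤q , post

  halts : ∀ {p σ} → nth searchProgram (pc σ) ≡ nothing → Post σ → HaltsWithin p σ
  halts {σ = σ} e post = 0 , σ , halted (cong (Maybe.map _) e) , z≤n , post

  executes : ∀ {p i σ} → nth searchProgram (pc σ) ≡ just i →
             HaltsWithin p (exec i σ) → HaltsWithin (suc p) σ
  executes e (t , τ , run , t≤p , post) =
    suc t , τ , next (cong (Maybe.map _) e) run , s≤s t≤p , post

  wrap-small : ∀ {x} → x ≤ 4 * n → wrap x ≡ x
  wrap-small x≤4n = m<n⇒m%n≡m {{m^n≢0 2 w}} (≤-<-trans x≤4n 4n<2^w)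

  n≤4n : n ≤ 4 * n
  n≤4n = m≤m+n n (3 * n)

  1+n≤4n : suc n ≤ 4 * n
  1+n≤4n = ≤-trans (+-monoˡ-≤ n 1≤n) (+-monoʳ-≤ n (m≤m+n n (2 * n)))

  name≤n : ∀ (v : Fin n) → name v ≤ n
  name≤n = toℕ<n

  nameOf≤n : ∀ (c : Maybe (Fin n)) → nameOf c ≤ n
  nameOf≤n (just v) = name≤n v
  nameOf≤n nothing  = z≤n

  module _ {p pc : ℕ} {ρ μ : ℕ → ℕ} where

    writes : ∀ {r x z} → x ≡ z → z ≤ 4 * n →
             HaltsWithin p (state (suc pc) (ρ [ r ≔ z ]) μ) →
             HaltsWithin p (set r x (state pc ρ μ))
    writes {r} refl z≤ = subst (λ z → HaltsWithin p (state (suc pc) (ρ [ r ≔ z ]) μ)) (sym (wrap-small z≤))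

    run-const : ∀ {r k} → nth searchProgram pc ≡ just (const r k) → k ≤ 4 * n →
                HaltsWithin p (state (suc pc) (ρ [ r ≔ k ]) μ) → HaltsWithin (suc p) (state pc ρ μ)
    run-const e k≤ h = executes e (writes refl k≤ h)

    run-add : ∀ {r s t} z → nth searchProgram pc ≡ just (op add r s t) → ρ s + ρ t ≡ z → z ≤ 4 * n →
              HaltsWithin p (state (suc pc) (ρ [ r ≔ z ]) μ) → HaltsWithin (suc p) (state pc ρ μ)
    run-add z e e′ z≤ h = executes e (writes e′ z≤ h)

    run-eq-yes : ∀ {r s t} → nth searchProgram pc ≡ just (op eq r s t) → ρ s ≡ ρ t →
                 HaltsWithin p (state (suc pc) (ρ [ r ≔ 1 ]) μ) → HaltsWithin (suc p) (state pc ρ μ)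
    run-eq-yes {s = s} {t} e s≡t h =
      executes e (writes (cong fromBit (trans (cong (_≡ᵇ ρ t) s≡t) (≡ᵇ-refl (ρ t)))) (≤-trans 1≤n n≤4n) h)

    run-eq-no : ∀ {r s t} → nth searchProgram pc ≡ just (op eq r s t) → ρ s ≢ ρ t →
                HaltsWithin p (state (suc pc) (ρ [ r ≔ 0 ]) μ) → HaltsWithin (suc p) (state pc ρ μ)
    run-eq-no e s≢t h = executes e (writes (cong fromBit (≢⇒≡ᵇ-false _ _ s≢t)) z≤n h)

    run-load : ∀ {r a} → nth searchProgram pc ≡ just (load r a) → μ (ρ a) ≤ 4 * n →
               HaltsWithin p (state (suc pc) (ρ [ r ≔ μ (ρ a) ]) μ) → HaltsWithin (suc p) (state pc ρ μ)
    run-load e z≤ h = executes e (writes refl z≤ h)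

    run-store : ∀ {a s} → nth searchProgram pc ≡ just (store a s) →
                HaltsWithin p (state (suc pc) ρ (μ [ ρ a ≔ ρ s ])) → HaltsWithin (suc p) (state pc ρ μ)
    run-store = executes

    run-jump : ∀ {ℓ} → nth searchProgram pc ≡ just (jump ℓ) →
               HaltsWithin p (state ℓ ρ μ) → HaltsWithin (suc p) (state pc ρ μ)
    run-jump = executes

    run-jumpZero-yes : ∀ {r ℓ} → nth searchProgram pc ≡ just (jumpZero r ℓ) → ρ r ≡ 0 →
                       HaltsWithin p (state ℓ ρ μ) → HaltsWithin (suc p) (state pc ρ μ)
    run-jumpZero-yes {r} {ℓ} e r≡0 h = executes e
      (subst (λ z → HaltsWithin p (state (if z ≡ᵇ 0 then ℓ else suc pc) ρ μ)) (sym r≡0) h)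

    run-jumpZero-no : ∀ {r ℓ} → nth searchProgram pc ≡ just (jumpZero r ℓ) → ρ r ≢ 0 →
                      HaltsWithin p (state (suc pc) ρ μ) → HaltsWithin (suc p) (state pc ρ μ)
    run-jumpZero-no {r} {ℓ} e r≢0 h = executes e
      (subst (λ c → HaltsWithin p (state (if c then ℓ else suc pc) ρ μ)) (sym (≢⇒≡ᵇ-false _ 0 r≢0)) h)

    run-order : ∀ {r} → nth searchProgram pc ≡ just (order r) →
                HaltsWithin p (state (suc pc) (ρ [ r ≔ n ]) μ) → HaltsWithin (suc p) (state pc ρ μ)
    run-order e h = executes e (writes refl n≤4n h)

    run-neighbour : ∀ {r s i} z → nth searchProgram pc ≡ just (neighbour r s i) →
                    neighbourOf (ρ s) (ρ i) ≡ z → z ≤ 4 * n →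
                    HaltsWithin p (state (suc pc) (ρ [ r ≔ z ]) μ) → HaltsWithin (suc p) (state pc ρ μ)
    run-neighbour z e e′ z≤ h = executes e (writes e′ z≤ h)

  neighbourOf-next : ∀ c i {rest} → drop i (outs c) ≡ rest →
                     neighbourOf (nameOf c) i ≡ maybe′ name 0 (head rest)
  neighbourOf-next (just v) i refl rewrite vertex?-name v = refl
  neighbourOf-next nothing  i refl rewrite drop-[] {Fin n} i = refl

  index<n : ∀ c i {u us} → drop i (outs c) ≡ u ∷ us → i < n
  index<n (just v) i e = <-≤-trans (proj₁ (drop-∷ i (out v) e)) (degree≤n G v)
  index<n nothing  i e with () ← trans (sym (drop-[] i)) e

  record Regs (b : ℕ) (ρ : ℕ → ℕ) : Set where
    field
      r0 : ρ 0 ≡ 0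
      r1 : ρ 1 ≡ n
      r2 : ρ 2 ≡ 1
      r3 : ρ 3 ≡ suc n
      r4 : ρ 4 ≡ b
      r5 : ρ 5 ≡ b + n

  -- Work on the cells above b leaves the cells 1, …, b blank for the next pass.
  BlankUpTo : ℕ → (ℕ → ℕ) → Set
  BlankUpTo b μ = ∀ a → a ≤ b → μ a ≡ 0

  StartReachesAll : ℕ → Set
  StartReachesAll s = ∃[ ℓ ] s ≡ name ℓ × (∀ v → Star Edge ℓ v)

  -- Memory layout of a pass

  module Pass (b : ℕ) (b≤2n : b ≤ n + n) where

    link parent : (ℕ → ℕ) → Fin n → ℕ
    link   μ v = μ (b + n + name v)
    parent μ v = μ (b + name v)

    parentAddr≤ : ∀ v → b + name v ≤ 4 * n
    parentAddr≤ v = begin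
      b + name v      ≤⟨ +-mono-≤ b≤2n (name≤n v) ⟩
      n + n + n       ≡⟨ +-assoc n n n ⟩
      n + (n + n)     ≤⟨ +-monoʳ-≤ n (+-monoʳ-≤ n (m≤m+n n (1 * n))) ⟩
      4 * n           ∎
      where open ≤-Reasoning

    linkAddr≤ : ∀ v → b + n + name v ≤ 4 * n
    linkAddr≤ v = begin
      b + n + name v        ≤⟨ +-mono-≤ (+-monoˡ-≤ n b≤2n) (name≤n v) ⟩
      n + n + n + n         ≡⟨ +-assoc (n + n) n n ⟩
      n + n + (n + n)       ≡⟨ +-assoc n n (n + n) ⟩
      n + (n + (n + n))     ≡⟨ cong (λ z → n + (n + (n + z))) (sym (+-identityʳ n)) ⟩
      4 * n                 ∎
      where open ≤-Reasoning

    parentAddr≢linkAddr : ∀ (u v : Fin n) → b + name u ≢ b + n + name v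
    parentAddr≢linkAddr u v e = <⇒≱ (toℕ<n u)
      (subst (n ≤_)
        (suc-injective (trans (sym (+-suc n (toℕ v))) (sym (+-cancelˡ-≡ b _ _ (trans e (+-assoc b n (name v)))))))
        (m≤m+n n (toℕ v)))

    discoverAt : ℕ → ℕ → Fin n → (ℕ → ℕ) → ℕ → ℕ
    discoverAt top p u μ = (μ [ b + n + name u ≔ top ]) [ b + name u ≔ p ]

    discovers : ∀ top p u μ →
                Discovers (link μ) (parent μ) (link (discoverAt top p u μ)) (parent (discoverAt top p u μ)) u top p
    discovers top p u μ = record
      { link-u   = trans (update-other μ₁ π p λᵤ (parentAddr≢linkAddr u u ∘ sym)) (update-same μ λᵤ top)
      ; parent-u = update-same μ₁ π p
      ; link-≢   = λ v v≢u →
          trans (update-other μ₁ π p (b + n + name v) (parentAddr≢linkAddr u v ∘ sym))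
            (update-other μ λᵤ top (b + n + name v) (v≢u ∘ name-injective ∘ +-cancelˡ-≡ (b + n) _ _))
      ; parent-≢ = λ v v≢u →
          trans (update-other μ₁ π p (b + name v) (v≢u ∘ name-injective ∘ +-cancelˡ-≡ b _ _))
            (update-other μ λᵤ top (b + name v) (parentAddr≢linkAddr v u))
      }
      where
      λᵤ = b + n + name u
      π  = b + name u
      μ₁ = μ [ λᵤ ≔ top ]

    discoverAt-blank : ∀ top p u μ → BlankUpTo b μ → BlankUpTo b (discoverAt top p u μ)
    discoverAt-blank top p u μ blank a a≤b =
      trans (update-other (μ [ b + n + name u ≔ top ]) (b + name u) p a
              (<⇒≢ (≤-<-trans a≤b (m<m+n b (s≤s z≤n)))))
        (trans (update-other μ (b + n + name u) top a
                 (<⇒≢ (≤-<-trans a≤b (≤-<-trans (m≤m+n b n) (m<m+n (b + n) (s≤s z≤n))))))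
          (blank a a≤b))

    module _ {p : ℕ} {ρ μ : ℕ → ℕ} (R : Regs b ρ) (u : Fin n) (r11 : ρ 11 ≡ name u) (r10< : ρ 10 < n) where
      open Regs R

      private
        ρ₁ = (ρ [ 13 ≔ b + n + name u ]) [ 12 ≔ link μ u ]
        ρ₂ = (ρ₁ [ 6 ≔ name u ]) [ 13 ≔ b + name u ]

      afterSkip afterChild afterStart : ℕ → ℕ
      afterSkip  = ρ₁ [ 10 ≔ suc (ρ 10) ]
      afterChild = ρ₂ [ 10 ≔ suc (ρ 10) ]
      afterStart = (ρ₂ [ 8 ≔ name u ]) [ 10 ≔ suc (ρ 10) ]

      private
        next-index : ρ 10 + ρ 2 ≡ suc (ρ 10)
        next-index = trans (cong (ρ 10 +_) r2) (+-comm (ρ 10) 1)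

        index≤ : suc (ρ 10) ≤ 4 * n
        index≤ = ≤-trans r10< n≤4n

        examine : ∀ {p} → link μ u ≤ suc n → HaltsWithin p (state 10 ρ₁ μ) → HaltsWithin (2 + p) (state 8 ρ μ)
        examine l≤ h =
          run-add (b + n + name u) refl (cong₂ _+_ r5 r11) (linkAddr≤ u) (
          run-load refl (≤-trans l≤ 1+n≤4n) h)

        discover-regs : ∀ {p} → HaltsWithin p (state 16 ρ₂ (discoverAt (ρ 6) (ρ 9) u μ)) →
                        HaltsWithin (4 + p) (state 12 ρ₁ μ)
        discover-regs h =
          run-store refl (
          run-add (name u) refl (trans (cong₂ _+_ r11 r0) (+-identityʳ _)) (≤-trans (name≤n u) n≤4n) (
          run-add (b + name u) refl (cong₂ _+_ r4 r11) (parentAddr≤ u) (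
          run-store refl h)))

      run-skip : link μ u ≤ suc n → link μ u ≢ 0 →
                 HaltsWithin p (state 6 afterSkip μ) → HaltsWithin (6 + p) (state 8 ρ μ)
      run-skip l≤ l≢0 h =
        examine l≤ (
        run-jumpZero-no refl l≢0 (
        run-jump refl (
        run-add _ refl next-index index≤ (
        run-jump refl h))))

      run-child : link μ u ≡ 0 → ρ 9 ≢ 0 →
                  HaltsWithin p (state 6 afterChild (discoverAt (ρ 6) (ρ 9) u μ)) →
                  HaltsWithin (11 + p) (state 8 ρ μ)
      run-child l≡0 r9≢0 h =
        examine (subst (_≤ suc n) (sym l≡0) z≤n) (
        run-jumpZero-yes refl l≡0 (
        discover-regs (
        run-jumpZero-no refl r9≢0 (
        run-jump refl (
        run-add _ refl next-index index≤ (
        run-jump refl h))))))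

      run-start : link μ u ≡ 0 → ρ 9 ≡ 0 →
                  HaltsWithin p (state 6 afterStart (discoverAt (ρ 6) (ρ 9) u μ)) →
                  HaltsWithin (11 + p) (state 8 ρ μ)
      run-start l≡0 r9≡0 h =
        examine (subst (_≤ suc n) (sym l≡0) z≤n) (
        run-jumpZero-yes refl l≡0 (
        discover-regs (
        run-jumpZero-yes refl r9≡0 (
        run-add (name u) refl (trans (cong₂ _+_ r11 r0) (+-identityʳ _)) (≤-trans (name≤n u) n≤4n) (
        run-add _ refl next-index index≤ (
        run-jump refl h))))))

    -- One proof serves both passes: `exit` is what follows a pass, at cost `q`. The premise
    -- `n ≤ s₀` holds only in the second pass, whose start vertex is known to reach everything.
    module Loop (s₀ q : ℕ)
      (exit : ∀ {ρ μ : ℕ → ℕ} → Regs b ρ → BlankUpTo b μ → ρ 7 ≡ n →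
              Inv s₀ (ρ 7) (ρ 8) (ρ 6) (link μ) (parent μ) nothing [] [] → (n ≤ s₀ → StartReachesAll (ρ 8)) →
              HaltsWithin q (state 25 ρ μ)) where

      record At (ρ μ : ℕ → ℕ) (cur : Maybe (Fin n)) (rest xs : List (Fin n)) : Set where
        field
          regs′ : Regs b ρ
          blank : BlankUpTo b μ
          r9    : ρ 9 ≡ nameOf cur
          r10   : drop (ρ 10) (outs cur) ≡ rest
          last  : n ≤ s₀ → StartReachesAll (ρ 8)
          inv   : Inv s₀ (ρ 7) (ρ 8) (ρ 6) (link μ) (parent μ) cur rest xs

      -- 22 bounds the steps between two visits of label 6; it is attained when an
      -- unvisited start vertex is found.
      run : ∀ f {ρ μ cur rest xs} → At ρ μ cur rest xs → Φ (ρ 7) (link μ) rest xs ≤ f →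
            HaltsWithin (suc f * 22 + q) (state 6 ρ μ)
      run zero {ρ} {μ} {rest = u ∷ us} {xs} at Φ≤
        with () ← subst (_≤ 0) (Φ-rest (ρ 7) (link μ) u us xs) Φ≤
      run (suc f) {ρ} {μ} {cur} {u ∷ us} {xs} at Φ≤ = weaken (+-monoˡ-≤ (suc f * 22 + q) (≤ᵇ⇒≤ 13 22 tt)) (
        run-neighbour (name u) refl
          (trans (cong (λ v → neighbourOf v (ρ 10)) r9) (neighbourOf-next cur (ρ 10) r10))
          (≤-trans (name≤n u) n≤4n) (
        run-jumpZero-no refl (λ ()) (
        visit cur refl)))
        where
        open At at
        Φ≤f : Φ (ρ 7) (link μ) us xs ≤ f
        Φ≤f = ≤-pred (subst (_≤ suc f) (Φ-rest (ρ 7) (link μ) u us xs) Φ≤)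
        i<n : ρ 10 < n
        i<n = index<n cur (ρ 10) r10
        R : Regs b (ρ [ 11 ≔ name u ])
        R = record { Regs regs′ }
        visit : ∀ c → c ≡ cur → HaltsWithin (11 + (suc f * 22 + q)) (state 8 (ρ [ 11 ≔ name u ]) μ)
        visit nothing refl with () ← trans (sym (drop-[] (ρ 10))) r10
        visit (just v) refl with link μ u ≟ 0
        ... | no  l≢0 = weaken (+-monoˡ-≤ (suc f * 22 + q) (≤ᵇ⇒≤ 6 11 tt))
          (run-skip R u refl i<n (Inv.bounded inv u) l≢0 (run f (record
            { regs′ = record { Regs regs′ }
            ; blank = blank
            ; r9    = r9
            ; r10   = proj₂ (drop-∷ (ρ 10) (out v) r10)
            ; last  = last
            ; inv   = skip l≢0 inv
            }) Φ≤f))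
        ... | yes l≡0 = run-child R u refl i<n l≡0 (subst (_≢ 0) (sym r9) (λ ())) (run f (record
            { regs′ = record { Regs regs′ }
            ; blank = discoverAt-blank _ _ u μ blank
            ; r9    = r9
            ; r10   = proj₂ (drop-∷ (ρ 10) (out v) r10)
            ; last  = last
            ; inv   = discoverChild disc l≡0 inv
            }) (subst (_≤ f) (sym (Φ-discovers disc l≡0 (top≢0 (Inv.stack inv)) (ρ 7) us xs)) Φ≤f))
          where
          disc : Discovers _ _ (link (discoverAt (ρ 6) (ρ 9) u μ)) (parent (discoverAt (ρ 6) (ρ 9) u μ)) u (ρ 6) (name v)
          disc = subst (Discovers _ _ _ _ u (ρ 6)) r9 (discovers (ρ 6) (ρ 9) u μ)
      run f {ρ} {μ} {cur} {[]} {xs} at Φ≤ =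
        run-neighbour 0 refl
          (trans (cong (λ v → neighbourOf v (ρ 10)) r9) (neighbourOf-next cur (ρ 10) r10)) z≤n (
        run-jumpZero-yes refl refl (
        choose f xs (finish inv) Φ≤))
        where
        open At at
        open Regs regs′
        ρ₁ = ρ [ 11 ≔ 0 ]

        scan : ∀ f → ρ 7 < n → Inv s₀ (ρ 7) (ρ 8) (ρ 6) (link μ) (parent μ) nothing [] [] →
               Φ (ρ 7) (link μ) [] [] ≤ suc f →
               HaltsWithin (16 + (suc f * 22 + q)) (state 30 ((ρ₁ [ 12 ≔ 1 ]) [ 12 ≔ 0 ]) μ)
        scan f s<n inv Φ≤ =
          run-add (suc (ρ 7)) refl (trans (cong (ρ 7 +_) r2) (+-comm (ρ 7) 1)) (≤-trans s<n n≤4n) (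
          run-add (name u) refl (trans (cong (suc (ρ 7) +_) r0) (trans (+-identityʳ _) (sym u≡s)))
            (≤-trans (name≤n u) n≤4n) (
          run-const refl z≤n (
          run-const refl z≤n (
          run-jump refl visit))))
          where
          u = fromℕ< s<n
          u≡s : name u ≡ suc (ρ 7)
          u≡s = cong suc (toℕ-fromℕ< s<n)
          ρ₂ = (((((ρ₁ [ 12 ≔ 1 ]) [ 12 ≔ 0 ]) [ 7 ≔ suc (ρ 7) ]) [ 11 ≔ name u ]) [ 9 ≔ 0 ]) [ 10 ≔ 0 ]
          Φ≤f : Φ (suc (ρ 7)) (link μ) [] [] ≤ f
          Φ≤f = ≤-pred (subst (_≤ suc f) (Φ-scan (link μ) [] [] s<n) Φ≤)
          R : Regs b ρ₂
          R = record { Regs regs′ }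
          visit : HaltsWithin (11 + (suc f * 22 + q)) (state 8 ρ₂ μ)
          visit with link μ u ≟ 0
          ... | no  l≢0 = weaken (+-monoˡ-≤ (suc f * 22 + q) (≤ᵇ⇒≤ 6 11 tt))
            (run-skip R u refl 1≤n (Inv.bounded inv u) l≢0 (run f (record
              { regs′ = record { Regs regs′ }
              ; blank = blank
              ; r9    = refl
              ; r10   = refl
              ; last  = last
              ; inv   = advance s<n l≢0 inv
              }) Φ≤f))
          ... | yes l≡0 = run-start R u refl 1≤n l≡0 refl (run f (record
              { regs′ = record { Regs regs′ }
              ; blank = discoverAt-blank _ _ u μ blank
              ; r9    = refl
              ; r10   = refl
              -- Register 8 has just changed, but a new start is found only while `s₀ ≤ ρ 7 < n`,
              -- where this claim is vacuous.
              ; last  = λ n≤s₀ → ⊥-elim (<⇒≱ (≤-<-trans (Inv.s₀≤s inv) s<n) n≤s₀)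
              ; inv   = advance s<n (visited-u disc l≡0 t≢0)
                          (discoverStart disc l≡0 (unvisited⇒lost inv s<n l≡0) inv)
              }) (subst (_≤ f) (sym (Φ-discovers disc l≡0 t≢0 (suc (ρ 7)) [] [])) Φ≤f))
            where
            disc = discovers (ρ 6) 0 u μ
            t≢0 = top≢0 (Inv.stack inv)

        choose : ∀ f xs → Inv s₀ (ρ 7) (ρ 8) (ρ 6) (link μ) (parent μ) nothing [] xs →
                 Φ (ρ 7) (link μ) [] xs ≤ f → HaltsWithin (20 + (f * 22 + q)) (state 21 ρ₁ μ)
        choose zero (v ∷ xs) inv Φ≤ with () ← subst (_≤ 0) (Φ-pop (ρ 7) (link μ) v xs) Φ≤
        choose (suc f) (v ∷ xs) inv Φ≤ = weaken (+-monoˡ-≤ (suc f * 22 + q) (≤ᵇ⇒≤ 7 20 tt)) (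
          run-eq-no refl (λ e → <⇒≢ (s≤s (toℕ<n v)) (trans (sym r6) (trans e r3))) (
          run-jumpZero-yes refl refl (
          run-add (name v) refl (trans (cong₂ _+_ r6 r0) (+-identityʳ _)) (≤-trans (name≤n v) n≤4n) (
          run-add (b + n + name v) refl (cong₂ _+_ r5 r6) (linkAddr≤ v) (
          run-load refl (≤-trans (Inv.bounded inv v) 1+n≤4n) (
          run-const refl z≤n (
          run-jump refl (run f (record
            { regs′ = record { Regs regs′ }
            ; blank = blank
            ; r9    = refl
            ; r10   = refl
            ; last  = last
            ; inv   = pop inv
            }) (≤-pred (subst (_≤ suc f) (Φ-pop (ρ 7) (link μ) v xs) Φ≤))))))))))
          where
          top-of : ∀ {t v xs} → Stack (link μ) t (v ∷ xs) → t ≡ name v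
          top-of (push _) = refl
          r6 : ρ 6 ≡ name v
          r6 = top-of (Inv.stack inv)
        choose f [] inv Φ≤ =
          run-eq-yes refl (trans (bottom (Inv.stack inv)) (sym r3)) (
          run-jumpZero-no refl (λ ()) (
          untried f Φ≤))
          where
          bottom : ∀ {t} → Stack (link μ) t [] → t ≡ suc n
          bottom [] = refl
          untried : ∀ f → Φ (ρ 7) (link μ) [] [] ≤ f →
                    HaltsWithin (18 + (f * 22 + q)) (state 23 (ρ₁ [ 12 ≔ 1 ]) μ)
          untried f Φ≤ with m≤n⇒m<n∨m≡n (Inv.s≤n inv)
          ... | inj₂ s≡n = weaken (m≤n⇒m≤o+n 16 (+-monoʳ-≤ 2 (m≤n+m q (f * 22)))) (
            run-eq-yes refl (trans s≡n (sym r1)) (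
            run-jumpZero-no refl (λ ()) (
            exit (record { Regs regs′ }) blank s≡n inv last)))
          untried zero Φ≤ | inj₁ s<n with () ← subst (_≤ 0) (Φ-scan (link μ) [] [] s<n) Φ≤
          untried (suc f) Φ≤ | inj₁ s<n =
            run-eq-no refl (λ e → <⇒≢ s<n (trans e r1)) (
            run-jumpZero-yes refl refl (
            scan f s<n inv Φ≤))

-- Both passes together

module Correctness (w n : ℕ) .{{_ : NonZero n}} (G : Digraph n) (4n<2^w : 4 * n < 2 ^ w)
                   {r : Fin n} (r↝ : ∀ (v : Fin n) → Star (Digraph.Edge G) r v) where
  open Digraph G
  open WordRAM w G
  open Search G

  OutputsDST : State → Set₁
  OutputsDST τ = Σ[ E′ ∈ Rel (Fin n) 0ℓ ] (IsDST G E′ × Represents (mem τ) E′)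

  open Machine w n G 4n<2^w (>-nonZero⁻¹ n) OutputsDST

  m = edgeCount

  module First  = Pass (n + n) ≤-refl
  module Second = Pass 0 z≤n

  output : ∀ {ρ μ} → Regs 0 ρ → BlankUpTo 0 μ → ρ 7 ≡ n →
           Inv n (ρ 7) (ρ 8) (ρ 6) (Second.link μ) (Second.parent μ) nothing [] [] →
           (n ≤ n → StartReachesAll (ρ 8)) →
           HaltsWithin 1 (state 25 ρ μ)
  output {ρ} {μ} R blank s≡n inv last with last ≤-refl
  -- The base 0 triggers the jump to label 40, just past the last instruction.
  ... | ℓ , last≡ , ℓ↝ = run-jumpZero-yes refl (Regs.r4 R) (halts refl
    (parents⇒DST G μ (proj₂ (Inv.start inv ℓ last≡)) (Inv.tree inv) (tree-spans inv ≤-refl last≡ ℓ↝)))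

  module Loop₂ = Second.Loop n 1 output

  -- Of the 19 instructions, 5 switch the base and fetch the start vertex, 3 reset the current
  -- vertex and the index, and 11 discover the start vertex.
  restart : ∀ {ρ μ} → Regs (n + n) ρ → BlankUpTo (n + n) μ → ρ 7 ≡ n →
            Inv 0 (ρ 7) (ρ 8) (ρ 6) (First.link μ) (First.parent μ) nothing [] [] →
            (n ≤ 0 → StartReachesAll (ρ 8)) →
            HaltsWithin (19 + (suc (n + m) * 22 + 1)) (state 25 ρ μ)
  restart {ρ} {μ} R blank s≡n inv _
    with last-reaches-all inv r↝ (Inv.scanned inv r z≤n (subst (toℕ r <_) (sym s≡n) (toℕ<n r)))
  ... | ℓ , last≡ , ℓ↝ =
    run-jumpZero-no refl (λ e → 2n≢0 (trans (sym r4) e)) (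
    run-const refl z≤n (
    run-add n refl (trans (cong₂ _+_ r1 r0) (+-identityʳ n)) n≤4n (
    run-add (name ℓ) refl (trans (cong₂ _+_ last≡ r0) (+-identityʳ _)) (≤-trans (name≤n ℓ) n≤4n) (
    run-jump refl (
    run-const refl z≤n (
    run-const refl z≤n (
    run-jump refl (
    Second.run-start R₀ ℓ refl (>-nonZero⁻¹ n) (link≡0 ℓ) refl (
    Loop₂.run (n + m) (record
      { regs′ = record { Regs R₀ }
      ; blank = Second.discoverAt-blank _ _ ℓ μ (λ a a≤0 → blank a (≤-trans a≤0 z≤n))
      ; r9    = refl
      ; r10   = refl
      ; last  = λ _ → ℓ , refl , ℓ↝
      ; inv   = discoverStart disc (link≡0 ℓ) (λ v vis → ⊥-elim (vis (link≡0 v))) inv₀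
      }) Φ≤)))))))))
    where
    open Regs R
    ρ₀ = (((((ρ [ 4 ≔ 0 ]) [ 5 ≔ n ]) [ 11 ≔ name ℓ ]) [ 9 ≔ 0 ]) [ 10 ≔ 0 ])

    2n≢0 : n + n ≢ 0
    2n≢0 e = >⇒≢ (>-nonZero⁻¹ n) (m+n≡0⇒m≡0 n e)

    link≡0 : ∀ v → Second.link μ v ≡ 0
    link≡0 v = blank (n + name v) (+-monoʳ-≤ n (name≤n v))

    parent≡0 : ∀ v → Second.parent μ v ≡ 0
    parent≡0 v = blank (name v) (≤-trans (name≤n v) (m≤m+n n n))

    R₀ : Regs 0 ρ₀
    R₀ = record { Regs R hiding (r4; r5) ; r4 = refl ; r5 = refl }

    bottom : ∀ {t} → Stack (First.link μ) t [] → t ≡ suc n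
    bottom [] = refl

    -- Taking 0 for the latest start pretends that none was chosen, until `discoverStart` installs
    -- `ℓ`. Register 6 still holds the bottom mark left by the empty stack of the first pass.
    inv₀ : Inv n (ρ 7) 0 (ρ 6) (Second.link μ) (Second.parent μ) nothing [] []
    inv₀ = subst (λ t → Inv n (ρ 7) 0 t (Second.link μ) (Second.parent μ) nothing [] [])
             (sym (bottom (Inv.stack inv))) (Inv-initial (sym s≡n) (≤-reflexive s≡n) link≡0 parent≡0)

    disc = Second.discovers (ρ 6) 0 ℓ μ

    Φ≤ : Φ (ρ 7) (Second.link (Second.discoverAt (ρ 6) 0 ℓ μ)) [] (ℓ ∷ []) ≤ n + m
    Φ≤ = ≤-reflexive (begin
      Φ (ρ 7) (Second.link (Second.discoverAt (ρ 6) 0 ℓ μ)) [] (ℓ ∷ [])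
        ≡⟨ Φ-discovers disc (link≡0 ℓ) (top≢0 (Inv.stack inv)) (ρ 7) [] [] ⟩
      unseenWeight (Second.link μ) + 0 + 0 + (n ∸ ρ 7)
        ≡⟨ cong₂ (λ a b → a + 0 + 0 + b) (unseenWeight-fresh link≡0) (m≤n⇒m∸n≡0 (≤-reflexive (sym s≡n))) ⟩
      n + m + 0 + 0 + 0
        ≡⟨ solve₀ (n + m) ⟩
      n + m ∎)
      where
      open ≡-Reasoning
      solve₀ : ∀ a → a + 0 + 0 + 0 ≡ a
      solve₀ = solve-∀

  module Loop₁ = First.Loop 0 (19 + (suc (n + m) * 22 + 1)) restart

  computesDST : HaltsWithin (6 + (suc (n + m + n) * 22 + (19 + (suc (n + m) * 22 + 1)))) initial
  computesDST =
    run-order refl (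
    run-const refl (≤-trans (>-nonZero⁻¹ n) n≤4n) (
    run-add (suc n) refl (+-comm n 1) 1+n≤4n (
    run-add (n + n) refl refl (+-monoʳ-≤ n (m≤m+n n (2 * n))) (
    run-add (n + n + n) refl refl
      (subst (_≤ 4 * n) (sym (+-assoc n n n)) (+-monoʳ-≤ n (+-monoʳ-≤ n (m≤m+n n (1 * n))))) (
    run-add (suc n) refl (+-identityʳ (suc n)) 1+n≤4n (
    -- The unseen weight is `n + m`, and another `n` pays for trying all start vertices.
    Loop₁.run (n + m + n) (record
      { regs′ = record { r0 = refl ; r1 = refl ; r2 = refl ; r3 = refl ; r4 = refl ; r5 = refl }
      ; blank = λ _ _ → refl
      ; r9    = refl
      ; r10   = refl
      ; last  = λ n≤0 → ⊥-elim (<⇒≱ (>-nonZero⁻¹ n) n≤0)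
      ; inv   = Inv-initial refl z≤n (λ _ → refl) (λ _ → refl)
      }) (≤-reflexive (cong (_+ n) (trans (+-identityʳ _) (trans (+-identityʳ _)
            (unseenWeight-fresh {λ _ → 0} (λ _ → refl))))))))))))

  -- The total is at most 110 m + 136, so 154 = 7 · 22 leaves slack.
  time≤ : n ≤ suc m →
          6 + (suc (n + m + n) * 22 + (19 + (suc (n + m) * 22 + 1))) ≤ 154 * (1 + m)
  time≤ n≤1+m = begin
    6 + (suc (n + m + n) * 22 + (19 + (suc (n + m) * 22 + 1))) ≡⟨ collect n m ⟩
    66 * n + (44 * m + 70)                                     ≤⟨ +-monoˡ-≤ _ (*-monoʳ-≤ 66 n≤1+m) ⟩
    66 * suc m + (44 * m + 70)                                 ≤⟨ m≤m+n _ (44 * m + 18) ⟩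
    66 * suc m + (44 * m + 70) + (44 * m + 18)                 ≡⟨ collect′ m ⟩
    154 * (1 + m)                                              ∎
    where
    open ≤-Reasoning
    collect : ∀ n m → 6 + (suc (n + m + n) * 22 + (19 + (suc (n + m) * 22 + 1))) ≡ 66 * n + (44 * m + 70)
    collect = solve-∀
    collect′ : ∀ m → 66 * suc m + (44 * m + 70) + (44 * m + 18) ≡ 154 * (1 + m)
    collect′ = solve-∀

-- Three bits beyond the logarithm give 8n, room for every address and value up to 4n.
4n<2^w : ∀ n w .{{_ : NonZero n}} → 3 * (1 + ⌈log₂ n ⌉) ≤ w → 4 * n < 2 ^ w
4n<2^w n w big = begin-strict
  4 * n             <⟨ *-monoˡ-< n (≤ᵇ⇒≤ 5 8 tt) ⟩
  8 * n             ≤⟨ *-monoʳ-≤ 8 (n≤2^⌈log₂n⌉ n) ⟩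
  8 * 2 ^ ⌈log₂ n ⌉ ≡⟨ ^-distribˡ-+-* 2 3 ⌈log₂ n ⌉ ⟨
  2 ^ (3 + ⌈log₂ n ⌉)
    ≤⟨ ^-monoʳ-≤ 2 (≤-trans (+-monoʳ-≤ 3 (m≤m+n ⌈log₂ n ⌉ _))
                      (≤-trans (≤-reflexive (sym (*-suc 3 ⌈log₂ n ⌉))) big)) ⟩
  2 ^ w             ∎
  where open ≤-Reasoning

theorem9 : Σ[ P ∈ Program ] Σ[ c ∈ ℕ ] Σ[ k ∈ ℕ ]
    (∀ (n : ℕ) .{{_ : NonZero n}} (G : Digraph n) (w : ℕ) →
    let open WordRAM w G in
    k * (1 + ⌈log₂ n ⌉) ≤ w →
    (Σ[ E′ ∈ Rel (Fin n) 0ℓ ] IsDST G E′) →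
    Σ[ t ∈ ℕ ] Σ[ τ ∈ State ]
    ((P ⊢ initial ⇓[ t ] τ) ×
    (t ≤ c * (1 + Digraph.edgeCount G)) ×
    (Σ[ E′ ∈ Rel (Fin n) 0ℓ ] (IsDST G E′ × Represents (mem τ) E′))))
theorem9 = searchProgram , 154 , 3 , λ n G w big (_ , dst) →
  let r , r↝ = DST⇒root G dst
      open Correctness w n G (4n<2^w n w big) r↝
      t , τ , run , t≤ , out = computesDST
  in t , τ , run , ≤-trans t≤ (time≤ (n≤1+edgeCount G r↝)) , out
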